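{- Let $S$ be a lattice of finite length and let $(L_x)_{x\in S}$ be an $S$-glued system of semimodular lattices of finite length, each of breadth at most $n$. Then the $S$-glued sum $L$ is semimodular and has breadth at most $n$.
   Context: A partially ordered set is of finite length if every chain in it is finite. Write $x\prec y$ if $y$ covers $x$. A finite-length lattice is semimodular if $a\prec b$, $a\prec c$ and $b\neq c$ imply $b\prec b+c$ and $c\prec b+c$. The breadth of a lattice $L$ is the supremum of all $n$ for which there is a map $\phi$ from the Boolean lattice $\mathbf 2^n$ into $L$ such that $\phi(a)\le\phi(b)$ if and only if $a\le b$, for all $a,b\in\mathbf 2^n$. $S$ has order $\le$, join $\vee$ and meet $\wedge$. Each $L_x$ has order $\le_x$; the underlying sets need not be disjoint. The family is an $S$-glued system if for all $x,y\in S$: (1) if $x\le y$ and $L_x\cap L_y\ne\emptyset$, then $L_x\cap L_y$ is a filter of $L_x$ and an ideal of $L_y$; (2) if $x\le y$, then for $a,b\in L_x\cap L_y$ we have $a\le_x b\iff a\le_y b$; (3) if $x\prec y$, then $L_x\cap L_y\ne\emptyset$; (4) $L_x\cap L_y\subseteq L_{x\wedge y}\cap L_{x\vee y}$. A filter is a nonempty up-closed subset closed under meets; an ideal is the dual notion. The $S$-glued sum is $L=\bigcup_x L_x$, ordered by the transitive closure of $\bigcup_x\le_x$. It is a lattice. -}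

module Defs where

open import Data.Nat using (ℕ) renaming (_≤_ to _≤ℕ_)
open import Data.Fin using (Fin)
open import Data.Bool using (Bool; true; false)
open import Data.List using (List)
open import Data.List.Membership.Propositional using (_∈_)
open import Data.Product using (Σ; ∃; _×_; _,_)
open import Data.Sum using (_⊎_)
open import Data.Unit using (⊤)
open import Data.Empty using (⊥)
open import Relation.Binary.PropositionalEquality using (_≡_; _≢_)
open import Relation.Binary.Construct.Closure.Transitive using (TransClosure)

-- All ordered sets below are subsets P : A → Set of an ambient type A,
-- carrying an order relation R : A → A → Set (only meaningful on P).
-- Equality of elements is propositional equality on A.

module _ {A : Set} (P : A → Set) (R : A → A → Set) where

  IsJoin : A → A → A → Set
  IsJoin a b j = P j × R a j × R b j × (∀ z → P z → R a z → R b z → R j z)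

  IsMeet : A → A → A → Set
  IsMeet a b m = P m × R m a × R m b × (∀ z → P z → R z a → R z b → R z m)

  record IsLattice : Set where
    field
      refl    : ∀ {a} → P a → R a a
      antisym : ∀ {a b} → P a → P b → R a b → R b a → a ≡ b
      trans   : ∀ {a b c} → P a → P b → P c → R a b → R b c → R a c
      _∨_     : A → A → A
      _∧_     : A → A → A
      ∨-join  : ∀ {a b} → P a → P b → IsJoin a b (a ∨ b)
      ∧-meet  : ∀ {a b} → P a → P b → IsMeet a b (a ∧ b)

  IsChain : (A → Set) → Set
  IsChain C = (∀ a → C a → P a) × (∀ a b → C a → C b → R a b ⊎ R b a)

  IsFiniteSubset : (A → Set) → Set
  IsFiniteSubset C = Σ (List A) λ xs → ∀ a → C a → a ∈ xs

  FiniteLength : Set₁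
  FiniteLength = ∀ (C : A → Set) → IsChain C → IsFiniteSubset C

  Covers : A → A → Set
  Covers a b = R a b × a ≢ b ×
    (∀ z → P z → R a z → R z b → z ≢ a → z ≢ b → ⊥)

  Semimodular : Set
  Semimodular = ∀ a b c j → P a → P b → P c →
    Covers a b → Covers a c → b ≢ c → IsJoin b c j →
    Covers b j × Covers c j

  _≤B_ : Bool → Bool → Set
  false ≤B _    = ⊤
  true  ≤B true = ⊤
  true  ≤B false = ⊥

  _⊆B_ : {m : ℕ} → (Fin m → Bool) → (Fin m → Bool) → Set
  s ⊆B t = ∀ i → s i ≤B t i

  IsOrderEmbeddingOf2^ : (m : ℕ) → ((Fin m → Bool) → A) → Set
  IsOrderEmbeddingOf2^ m φ = (∀ s → P (φ s)) ×
    (∀ s t → (R (φ s) (φ t) → s ⊆B t) × (s ⊆B t → R (φ s) (φ t)))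

  BreadthAtMost : ℕ → Set
  BreadthAtMost n = ∀ m (φ : (Fin m → Bool) → A) → IsOrderEmbeddingOf2^ m φ → m ≤ℕ n

record FLLattice : Set₁ where
  field
    Carrier    : Set
    _≤_          : Carrier → Carrier → Set
    isLattice  : IsLattice (λ _ → ⊤) _≤_
    finiteLength : FiniteLength (λ _ → ⊤) _≤_
  open IsLattice isLattice public

-- A family (L_x)_{x ∈ S} of lattices of finite length on subsets of a common
-- ambient type U (underlying sets may overlap).
record Family (S : FLLattice) (U : Set) : Set₁ where
  open FLLattice S using (Carrier)
  field
    Mem          : Carrier → U → Set
    Le           : Carrier → U → U → Set
    isLattice    : ∀ x → IsLattice (Mem x) (Le x)
    finiteLength : ∀ x → FiniteLength (Mem x) (Le x)

module _ {S : FLLattice} {U : Set} (F : Family S U) where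
  open FLLattice S using (Carrier) renaming (_≤_ to _≤S_; _∨_ to _∨S_; _∧_ to _∧S_)
  open Family F

  Inter : Carrier → Carrier → U → Set
  Inter x y a = Mem x a × Mem y a

  IsFilterOf : Carrier → (U → Set) → Set
  IsFilterOf x F' = (∃ λ a → F' a) × (∀ a → F' a → Mem x a) ×
    (∀ a b → F' a → Mem x b → Le x a b → F' b) ×
    (∀ a b → F' a → F' b → F' (IsLattice._∧_ (isLattice x) a b))

  IsIdealOf : Carrier → (U → Set) → Set
  IsIdealOf y I = (∃ λ a → I a) × (∀ a → I a → Mem y a) ×
    (∀ a b → I a → Mem y b → Le y b a → I b) ×
    (∀ a b → I a → I b → I (IsLattice._∨_ (isLattice y) a b))

  record IsGluedSystem : Set where
    field
      glue1 : ∀ x y → x ≤S y → (∃ λ a → Inter x y a) →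
                IsFilterOf x (Inter x y) × IsIdealOf y (Inter x y)
      glue2 : ∀ x y → x ≤S y → ∀ a b → Inter x y a → Inter x y b →
                (Le x a b → Le y a b) × (Le y a b → Le x a b)
      glue3 : ∀ x y → Covers (λ _ → ⊤) _≤S_ x y → ∃ λ a → Inter x y a
      glue4 : ∀ x y a → Inter x y a → Inter (x ∧S y) (x ∨S y) a

  InSum : U → Set
  InSum a = ∃ λ x → Mem x a

  Step : U → U → Set
  Step a b = ∃ λ x → Mem x a × Mem x b × Le x a b

  _≤Sum_ : U → U → Set
  _≤Sum_ = TransClosure Step

{-# OPTIONS --safe #-}

-- Each L_z is convex in the sum and inherits its order, and joins of L_z are
-- joins in the sum.  Hence two covers b, c of a lie, with a and their join, in a
-- single L_z, where semimodularity applies.  For the breadth, an embedding of 2^m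
-- gives p, a_j, s_i with p below everything and a_j ≤ s_i iff i ≠ j.  Choose
-- Step-paths from p to the a_j.  Their first nodes c_j lie in a common L_x
-- together with p.  If c_j ≰ s_j for all j, the joins of the c_j embed 2^m in L_x.
-- If c_j ≤ s_j for some j, replace p by c_j and each a_k by a_k ∨ c_j, which
-- shortens the j-th path and does not lengthen the others.
module Submission where

open import Defs
open import Data.Nat using (ℕ; zero; suc; _+_; _≤_; _<_; z≤n; _≤?_)
open import Data.Nat.Properties using (≤-refl; <⇒≤; ≤-reflexive; +-mono-≤; +-mono-<-≤; +-mono-≤-<)
open import Data.Nat.Induction using (<-wellFounded)
open import Induction.WellFounded using (Acc; acc)
open import Data.Bool using (Bool; true; false; not)
open import Data.Fin using (Fin; zero; suc)
open import Data.Fin.Properties using (_≟_)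
open import Data.Product using (∃; ∃-syntax; Σ-syntax; _×_; _,_; proj₁; proj₂)
open import Data.Unit using (tt)
open import Data.Empty using (⊥-elim)
open import Function using (_∘_)
open import Relation.Nullary using (¬_; yes; no; does; contradiction)
open import Relation.Binary.PropositionalEquality using (_≡_; _≢_; refl; cong; subst)
open import Relation.Binary.Construct.Closure.ReflexiveTransitive using (Star; ε; _◅_; _◅◅_)
open import Relation.Binary.Construct.Closure.Transitive using (TransClosure; [_]; _∷_)

-- Sums of natural numbers over `Fin m`.

total : ∀ {m} → (Fin m → ℕ) → ℕ
total {zero}  f = 0
total {suc m} f = f zero + total (f ∘ suc)

total-mono-≤ : ∀ {m} {f g : Fin m → ℕ} → (∀ k → f k ≤ g k) → total f ≤ total g
total-mono-≤ {zero}  f≤g = z≤n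
total-mono-≤ {suc m} f≤g = +-mono-≤ (f≤g zero) (total-mono-≤ (f≤g ∘ suc))

total-mono-< : ∀ {m} {f g : Fin m → ℕ} → (∀ k → f k ≤ g k) →
               ∀ j → f j < g j → total f < total g
total-mono-< f≤g zero    fj<gj = +-mono-<-≤ fj<gj (total-mono-≤ (f≤g ∘ suc))
total-mono-< f≤g (suc j) fj<gj = +-mono-≤-< (f≤g zero) (total-mono-< (f≤g ∘ suc) j fj<gj)

-- Paths and their lengths.

module _ {A : Set} {R : A → A → Set} where

  toStar : ∀ {a b} → TransClosure R a b → Star R a b
  toStar [ r ]    = r ◅ ε
  toStar (r ∷ rs) = r ◅ toStar rs

  fromStar : ∀ {a b} → R a a → Star R a b → TransClosure R a b
  fromStar Raa ε        = [ Raa ]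
  fromStar Raa (r ◅ rs) = prepend r rs
    where
    prepend : ∀ {a b c} → R a b → Star R b c → TransClosure R a c
    prepend r ε         = [ r ]
    prepend r (r′ ◅ rs) = r ∷ prepend r′ rs

  len : ∀ {a b} → Star R a b → ℕ
  len ε        = 0
  len (_ ◅ rs) = suc (len rs)

module GluedSum {S : FLLattice} {U : Set} (F : Family S U) (G : IsGluedSystem F) where
  open FLLattice S using (Carrier) renaming (_≤_ to _≤S_; _∨_ to _∨S_; _∧_ to _∧S_)
  open Family F using (Mem; Le)
  open IsGluedSystem G
  private
    module S = FLLattice S
    module L (x : Carrier) = IsLattice (Family.isLattice F x)

  -- Order of `S` and lattice operations of the components.

  ≤S-trans : ∀ {x y z} → x ≤S y → y ≤S z → x ≤S z
  ≤S-trans = S.trans tt tt tt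

  x≤x∨y : ∀ {x y} → x ≤S (x ∨S y)
  x≤x∨y = proj₁ (proj₂ (S.∨-join tt tt))

  y≤x∨y : ∀ {x y} → y ≤S (x ∨S y)
  y≤x∨y = proj₁ (proj₂ (proj₂ (S.∨-join tt tt)))

  ∨S-least : ∀ {x y z} → x ≤S z → y ≤S z → (x ∨S y) ≤S z
  ∨S-least x≤z y≤z = proj₂ (proj₂ (proj₂ (S.∨-join tt tt))) _ tt x≤z y≤z

  x∧y≤x : ∀ {x y} → (x ∧S y) ≤S x
  x∧y≤x = proj₁ (proj₂ (S.∧-meet tt tt))

  x∧y≤y : ∀ {x y} → (x ∧S y) ≤S y
  x∧y≤y = proj₁ (proj₂ (proj₂ (S.∧-meet tt tt)))

  module _ {x a b} (a∈x : Mem x a) (b∈x : Mem x b) where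
    private
      join = L.∨-join x a∈x b∈x
      meet = L.∧-meet x a∈x b∈x

    _⊔_ : U
    _⊔_ = L._∨_ x a b

    ⊔-mem : Mem x _⊔_
    ⊔-mem = proj₁ join

    ⊔-upperˡ : Le x a _⊔_
    ⊔-upperˡ = proj₁ (proj₂ join)

    ⊔-upperʳ : Le x b _⊔_
    ⊔-upperʳ = proj₁ (proj₂ (proj₂ join))

    ⊔-least : ∀ {u} → Mem x u → Le x a u → Le x b u → Le x _⊔_ u
    ⊔-least = proj₂ (proj₂ (proj₂ join)) _

    _⊓_ : U
    _⊓_ = L._∧_ x a b

    ⊓-mem : Mem x _⊓_
    ⊓-mem = proj₁ meet

    ⊓-lowerˡ : Le x _⊓_ a
    ⊓-lowerˡ = proj₁ (proj₂ meet)

    ⊓-lowerʳ : Le x _⊓_ b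
    ⊓-lowerʳ = proj₁ (proj₂ (proj₂ meet))

    ⊓-greatest : ∀ {u} → Mem x u → Le x u a → Le x u b → Le x u _⊓_
    ⊓-greatest = proj₂ (proj₂ (proj₂ meet)) _

  -- Moving elements between components

  mem-∨ : ∀ {x y a} → Mem x a → Mem y a → Mem (x ∨S y) a
  mem-∨ a∈x a∈y = proj₂ (glue4 _ _ _ (a∈x , a∈y))

  mem-∧ : ∀ {x y a} → Mem x a → Mem y a → Mem (x ∧S y) a
  mem-∧ a∈x a∈y = proj₁ (glue4 _ _ _ (a∈x , a∈y))

  -- The element `a` witnesses that the two components meet, so by `glue1` their intersection is a
  -- filter of the one at `x`, which catches `b`; `glue2` transfers the inequality. `lower` is the
  -- dual, with the ideal.
  raise : ∀ {x y a b} → x ≤S y → Mem y a → Mem x a → Mem x b → Le x a b →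
          Mem y b × Le y a b
  raise {x} {y} {a} {b} x≤y a∈y a∈x b∈x a≤b =
    b∈y , proj₁ (glue2 x y x≤y a b (a∈x , a∈y) (b∈x , b∈y)) a≤b
    where
    b∈y = proj₂ (proj₁ (proj₂ (proj₂ (proj₁ (glue1 x y x≤y (a , a∈x , a∈y)))))
                   a b (a∈x , a∈y) b∈x a≤b)

  lower : ∀ {x y a b} → x ≤S y → Mem x a → Mem y a → Mem y b → Le y b a →
          Mem x b × Le x b a
  lower {x} {y} {a} {b} x≤y a∈x a∈y b∈y b≤a =
    b∈x , proj₂ (glue2 x y x≤y b a (b∈x , b∈y) (a∈x , a∈y)) b≤a
    where
    b∈x = proj₁ (proj₁ (proj₂ (proj₂ (proj₂ (glue1 x y x≤y (a , a∈x , a∈y)))))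
                   a b (a∈x , a∈y) b∈y b≤a)

  ⊓-mem-above : ∀ {x y a b} → x ≤S y → (a∈x : Mem x a) (b∈x : Mem x b) →
                Mem y a → Mem y b → Mem y (a∈x ⊓ b∈x)
  ⊓-mem-above {x} {y} {a} {b} x≤y a∈x b∈x a∈y b∈y =
    proj₂ (proj₂ (proj₂ (proj₂ (proj₁ (glue1 x y x≤y (a , a∈x , a∈y)))))
             a b (a∈x , a∈y) (b∈x , b∈y))

  ⊔-mem-below : ∀ {x y a b} → x ≤S y → (a∈y : Mem y a) (b∈y : Mem y b) →
                Mem x a → Mem x b → Mem x (a∈y ⊔ b∈y)
  ⊔-mem-below {x} {y} {a} {b} x≤y a∈y b∈y a∈x b∈x =
    proj₁ (proj₂ (proj₂ (proj₂ (proj₂ (glue1 x y x≤y (a , a∈x , a∈y)))))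
             a b (a∈x , a∈y) (b∈x , b∈y))

  up : ∀ {x y a b} → x ≤S y → Mem x a → Mem y a → Mem x b → Mem y b → Le x a b → Le y a b
  up x≤y a∈x a∈y b∈x b∈y = proj₁ (glue2 _ _ x≤y _ _ (a∈x , a∈y) (b∈x , b∈y))

  down : ∀ {x y a b} → x ≤S y → Mem x a → Mem y a → Mem x b → Mem y b → Le y a b → Le x a b
  down x≤y a∈x a∈y b∈x b∈y = proj₂ (glue2 _ _ x≤y _ _ (a∈x , a∈y) (b∈x , b∈y))

  -- Order of the sum

  infix 4 _⊑_
  -- `Star` supplies an empty path, the base case of the inductions. On elements of the sum it
  -- agrees with `_≤Sum_`, because `Step` is reflexive there.
  _⊑_ : U → U → Set
  _⊑_ = Star (Step F)

  step : ∀ {x a b} → Mem x a → Mem x b → Le x a b → a ⊑ b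
  step a∈x b∈x a≤b = (_ , a∈x , b∈x , a≤b) ◅ ε

  step-refl : ∀ {x a} → Mem x a → Step F a a
  step-refl a∈x = _ , a∈x , a∈x , L.refl _ a∈x

  -- By `glue4`, `a` also lies at `x ∨S y`, and `raise` carries the step up to that index. Hence a
  -- step from `a` can always be taken above a prescribed index containing `a`.
  raise-step : ∀ {x a b} → Mem x a → Step F a b →
               ∃[ y ] x ≤S y × Mem y a × Mem y b × Le y a b
  raise-step {x} a∈x (y , a∈y , b∈y , a≤b) =
    let a∈x∨y = mem-∨ a∈x a∈y
        b∈x∨y , a≤b′ = raise y≤x∨y a∈x∨y a∈y b∈y a≤b
    in x ∨S y , x≤x∨y , a∈x∨y , b∈x∨y , a≤b′

  ascend : ∀ {x a b} → Mem x a → a ⊑ b → ∃[ y ] x ≤S y × Mem y b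
  ascend a∈x ε = _ , S.refl tt , a∈x
  ascend a∈x (s ◅ r) =
    let y , x≤y , _ , c∈y , _ = raise-step a∈x s
        z , y≤z , b∈z = ascend c∈y r
    in z , ≤S-trans x≤y y≤z , b∈z

  -- Works from the end of the path: the meet of an index below `x` containing `c` with the index of
  -- the step still contains `c`, and by the ideal condition also `a`.
  descend : ∀ {x a b} → Mem x b → a ⊑ b → ∃[ y ] y ≤S x × Mem y a
  descend b∈x ε = _ , S.refl tt , b∈x
  descend b∈x ((y , a∈y , c∈y , a≤c) ◅ r) =
    let z , z≤x , c∈z = descend b∈x r
    in z ∧S y , ≤S-trans x∧y≤x z≤x ,
       proj₁ (lower x∧y≤y (mem-∧ c∈z c∈y) c∈y a∈y a≤c)

  -- Following the path back from `b` finds `c` at some `v` below `z`. The meet of `v` and `x`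
  -- contains `c`, hence also `a` by the ideal condition. It lies below `z` and shares `a` with it,
  -- so the filter condition puts `c` in the component at `z`.
  convex-step : ∀ {z a b c} → Mem z a → Mem z b → Step F a c → c ⊑ b →
                Mem z c × Le z a c
  convex-step a∈z b∈z (x , a∈x , c∈x , a≤c) c⊑b =
    let v , v≤z , c∈v = descend b∈z c⊑b
        c∈w = mem-∧ c∈v c∈x
        a∈w , a≤c′ = lower x∧y≤y c∈w c∈x a∈x a≤c
    in raise (≤S-trans x∧y≤x v≤z) a∈z a∈w c∈w a≤c′

  ⊑⇒Le : ∀ {z a b} → Mem z a → Mem z b → a ⊑ b → Le z a b
  ⊑⇒Le a∈z b∈z ε = L.refl _ a∈z
  ⊑⇒Le a∈z b∈z (s ◅ r) =
    let c∈z , a≤c = convex-step a∈z b∈z s r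
    in L.trans _ a∈z c∈z b∈z a≤c (⊑⇒Le c∈z b∈z r)

  convex : ∀ {z a b c} → Mem z a → Mem z b → a ⊑ c → c ⊑ b → Mem z c
  convex a∈z b∈z ε       c⊑b = a∈z
  convex a∈z b∈z (s ◅ r) c⊑b = convex (proj₁ (convex-step a∈z b∈z s (r ◅◅ c⊑b))) b∈z r c⊑b

  -- Joins

  -- The h found is s ∧ j: join the path from b to s with j, then meet it with j
  -- on the way back.
  interpolate : ∀ {x y w b j s} → x ≤S y → y ≤S w →
                Mem x b → Mem x j → Mem y j → Le x b j → b ⊑ s → Mem w s →
                ∃[ h ] Mem x h × Mem y h × Le x b h × Le x h j × h ⊑ s
  interpolate {x} {y} {w} {b} x≤y y≤w b∈x j∈x j∈y b≤j ε b∈w =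
    let x≤w = ≤S-trans x≤y y≤w
        -- Here `w` serves its purpose: `j` rises to `w` together with `b`, and `b` then drops from
        -- `w` to `y` below `j`.
        j∈w , b≤j′ = raise x≤w b∈w b∈x j∈x b≤j
        b∈y , _ = lower y≤w j∈y j∈w b∈w b≤j′
    in b , b∈x , b∈y , L.refl x b∈x , b≤j , ε
  interpolate {x} {y} {w} {b} {j} {s} x≤y y≤w b∈x j∈x j∈y b≤j (st ◅ r) s∈w =
    let z , x≤z , b∈z , b₁∈z , b≤b₁ = raise-step b∈x st
        j∈z , b≤j-z = raise x≤z b∈z b∈x j∈x b≤j
        d∈z = ⊔-mem b₁∈z j∈z
        j∈zy = mem-∨ j∈z j∈y
        d∈zy , _ = raise x≤x∨y j∈zy j∈z d∈z (⊔-upperʳ b₁∈z j∈z)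
        v , z≤v , s∈v = ascend b₁∈z r
        -- The recursion uses the indices `z` and `z ∨S y`, with the join of `b₁` and `j` in the
        -- role of `j`. Joining `w` with `v` keeps the top index above `z`.
        h₁ , h₁∈z , h₁∈zy , b₁≤h₁ , _ , h₁⊑s =
          interpolate x≤x∨y
            (∨S-least (≤S-trans z≤v y≤x∨y) (≤S-trans y≤w x≤x∨y))
            b₁∈z d∈z d∈zy (⊔-upperˡ b₁∈z j∈z) r (mem-∨ s∈w s∈v)
        h∈z = ⊓-mem h₁∈z j∈z
        h≤j-z = ⊓-lowerʳ h₁∈z j∈z
        h∈zy = ⊓-mem-above x≤x∨y h₁∈z j∈z h₁∈zy j∈zy
        h∈x , h≤j = lower x≤z j∈x j∈z h∈z h≤j-z
        h∈y , _ = lower y≤x∨y j∈y j∈zy h∈zy (up x≤x∨y h∈z h∈zy j∈z j∈zy h≤j-z)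
        b≤h-z = ⊓-greatest h₁∈z j∈z b∈z
                  (L.trans z b∈z b₁∈z h₁∈z b≤b₁ b₁≤h₁) b≤j-z
    in h₁∈z ⊓ j∈z , h∈x , h∈y , down x≤z b∈x b∈z h∈x h∈z b≤h-z , h≤j ,
       step h∈z h₁∈z (⊓-lowerˡ h₁∈z j∈z) ◅◅ h₁⊑s

  -- Induction on the path from `c`. Its next step happens at some `y` above `x`, where `b` need not
  -- lie, so `interpolate` replaces `b` by an `h` between `b` and `s` that lies in both components.
  -- The join of `b` and `c` is below that of `h` and `c`, which is below that of `h` and `c₁`,
  -- where induction applies.
  ⊔-least-sum : ∀ {x b c s} (b∈x : Mem x b) (c∈x : Mem x c) →
                b ⊑ s → c ⊑ s → (b∈x ⊔ c∈x) ⊑ s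
  ⊔-least-sum {x} b∈x c∈x b⊑s ε =
    step (⊔-mem b∈x c∈x) c∈x
      (⊔-least b∈x c∈x c∈x (⊑⇒Le b∈x c∈x b⊑s) (L.refl x c∈x))
  ⊔-least-sum {x} b∈x c∈x b⊑s (st ◅ r) =
    let y , x≤y , c∈y , c₁∈y , c≤c₁ = raise-step c∈x st
        j∈x = ⊔-mem b∈x c∈x
        j∈y , _ = raise x≤y c∈y c∈x j∈x (⊔-upperʳ b∈x c∈x)
        w , y≤w , s∈w = ascend c₁∈y r
        h , h∈x , h∈y , b≤h , _ , h⊑s =
          interpolate x≤y y≤w b∈x j∈x j∈y (⊔-upperˡ b∈x c∈x) b⊑s s∈w
        g∈y = ⊔-mem h∈y c∈y
        -- A join formed at `y` returns to `x` because the intersection is an ideal of the component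
        -- at `y`.
        g∈x = ⊔-mem-below x≤y h∈y c∈y h∈x c∈x
        h≤g = down x≤y h∈x h∈y g∈x g∈y (⊔-upperˡ h∈y c∈y)
        c≤g = down x≤y c∈x c∈y g∈x g∈y (⊔-upperʳ h∈y c∈y)
        j≤g = ⊔-least b∈x c∈x g∈x (L.trans x b∈x h∈x g∈x b≤h h≤g) c≤g
        k∈y = ⊔-mem h∈y c₁∈y
        g≤k = ⊔-least h∈y c∈y k∈y (⊔-upperˡ h∈y c₁∈y)
                (L.trans y c∈y c₁∈y k∈y c≤c₁ (⊔-upperʳ h∈y c₁∈y))
    in step j∈x g∈x j≤g ◅◅ step g∈y k∈y g≤k ◅◅ ⊔-least-sum h∈y c₁∈y h⊑s r

  -- a′ is the join of c and a.
  join-path : ∀ {x p c a} → Mem x p → Mem x c → Le x p c → (r : p ⊑ a) →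
              ∃[ a′ ] (Σ[ q ∈ c ⊑ a′ ] len q ≡ len r) × a ⊑ a′ ×
                      (∀ {s} → c ⊑ s → a ⊑ s → a′ ⊑ s)
  join-path p∈x c∈x p≤c ε = _ , (ε , refl) , step p∈x c∈x p≤c , λ c⊑s _ → c⊑s
  join-path p∈x c∈x p≤c (st ◅ r) =
    let y , x≤y , p∈y , p₁∈y , _ = raise-step p∈x st
        c∈y , _ = raise x≤y p∈y p∈x c∈x p≤c
        -- The step from `c` to its join with `p₁` replaces the step from `p` to `p₁`, so the length
        -- is preserved.
        d∈y = ⊔-mem c∈y p₁∈y
        a′ , (q , len≡) , a⊑a′ , least =
          join-path p₁∈y d∈y (⊔-upperʳ c∈y p₁∈y) r
    in a′ , ((y , c∈y , d∈y , ⊔-upperˡ c∈y p₁∈y) ◅ q , cong suc len≡) , a⊑a′ ,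
       λ c⊑s a⊑s → least (⊔-least-sum c∈y p₁∈y c⊑s (r ◅◅ a⊑s)) a⊑s

  -- Semimodularity

  -- An intermediate node of the path must be `a` or `b`, but which one is not decidable; hence the
  -- double negation.
  cover-step : ∀ {a b} → Covers (InSum F) (_≤Sum_ F) a b → ¬ ¬ Step F a b
  cover-step {a} {b} (a≤b , _ , gap) ¬step = search a≤b
    where
    search : ¬ TransClosure (Step F) a b
    search [ s ] = ¬step s
    search (s@(x , _ , c∈x , _) ∷ r) =
      gap _ (x , c∈x) [ s ] r (λ { refl → search r }) (λ { refl → ¬step s })

  restrict-cover : ∀ {z a b} → Mem z a → Mem z b → Le z a b →
                   Covers (InSum F) (_≤Sum_ F) a b → Covers (Mem z) (Le z) a b
  restrict-cover {z} a∈z b∈z a≤b (_ , a≢b , gap) =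
    a≤b , a≢b , λ w w∈z a≤w w≤b →
      gap w (z , w∈z) [ z , a∈z , w∈z , a≤w ] [ z , w∈z , b∈z , w≤b ]

  -- By convexity, everything between `a` and `b` in the sum already lies in the component at `z`.
  extend-cover : ∀ {z a b} → Mem z a → Mem z b →
                 Covers (Mem z) (Le z) a b → Covers (InSum F) (_≤Sum_ F) a b
  extend-cover {z} a∈z b∈z (a≤b , a≢b , gap) =
    [ z , a∈z , b∈z , a≤b ] , a≢b , λ w _ a≤w w≤b →
      let a⊑w = toStar a≤w
          w⊑b = toStar w≤b
          w∈z = convex a∈z b∈z a⊑w w⊑b
      in gap w w∈z (⊑⇒Le a∈z w∈z a⊑w) (⊑⇒Le w∈z b∈z w⊑b)

  -- The component's join is an upper bound in the sum, so `j` lies between `b` and it. Convexity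
  -- brings `j` into the component, where antisymmetry applies.
  sum-join : ∀ {z b c j} (b∈z : Mem z b) (c∈z : Mem z c) →
             IsJoin (InSum F) (_≤Sum_ F) b c j → (b∈z ⊔ c∈z) ≡ j
  sum-join {z} b∈z c∈z (_ , b≤j , c≤j , least) =
    L.antisym z k∈z j∈z
      (⊔-least b∈z c∈z j∈z (⊑⇒Le b∈z j∈z (toStar b≤j)) (⊑⇒Le c∈z j∈z (toStar c≤j)))
      (⊑⇒Le j∈z k∈z j⊑k)
    where
    k∈z = ⊔-mem b∈z c∈z
    j⊑k = toStar (least _ (z , k∈z) [ z , b∈z , k∈z , ⊔-upperˡ b∈z c∈z ]
                                    [ z , c∈z , k∈z , ⊔-upperʳ b∈z c∈z ])
    j∈z = convex b∈z k∈z (toStar b≤j) j⊑k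

  sum-semimodular : (∀ x → Semimodular (Mem x) (Le x)) →
                    Semimodular (InSum F) (_≤Sum_ F)
  sum-semimodular semi a b c j _ _ _ a≺b a≺c b≢c J@(_ , b≤j , c≤j , _) =
    -- Apart from `b≤j` and `c≤j`, the goal consists of negations, so its double negation suffices.
    (b≤j , (λ b≡j → stable λ cov → proj₁ (proj₂ (proj₁ cov)) b≡j) ,
       λ w p q r s t → stable λ cov → proj₂ (proj₂ (proj₁ cov)) w p q r s t) ,
    (c≤j , (λ c≡j → stable λ cov → proj₁ (proj₂ (proj₂ cov)) c≡j) ,
       λ w p q r s t → stable λ cov → proj₂ (proj₂ (proj₂ cov)) w p q r s t)
    where
    Goal = Covers (InSum F) (_≤Sum_ F) b j × Covers (InSum F) (_≤Sum_ F) c j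

    covers : Step F a b → Step F a c → Goal
    covers (x , a∈x , b∈x , a≤b) (y , a∈y , c∈y , a≤c) =
      let a∈z = mem-∨ a∈x a∈y
          b∈z , a≤b-z = raise x≤x∨y a∈z a∈x b∈x a≤b
          c∈z , a≤c-z = raise y≤x∨y a∈z a∈y c∈y a≤c
          k∈z = ⊔-mem b∈z c∈z
          b≺k , c≺k = semi (x ∨S y) a b c (b∈z ⊔ c∈z) a∈z b∈z c∈z
                        (restrict-cover a∈z b∈z a≤b-z a≺b)
                        (restrict-cover a∈z c∈z a≤c-z a≺c)
                        b≢c (L.∨-join _ b∈z c∈z)
      in subst (λ k → Covers (InSum F) (_≤Sum_ F) b k × Covers (InSum F) (_≤Sum_ F) c k)
           (sum-join b∈z c∈z J)
           (extend-cover b∈z k∈z b≺k , extend-cover c∈z k∈z c≺k)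

    stable : ¬ ¬ Goal
    stable ¬goal = cover-step a≺b λ s → cover-step a≺c λ t → ¬goal (covers s t)

  -- Breadth

  module _ {x p} (p∈x : Mem x p) where

    ⋁ : ∀ {m} {c : Fin m → U} → (∀ k → Mem x (c k)) → (Fin m → Bool) → ∃ (Mem x)
    -- The empty join is `p`, which keeps it in the component and below every `s i` of a crown.
    ⋁ {zero}  c∈x T = p , p∈x
    ⋁ {suc m} c∈x T with T zero
    ... | true  = _ , ⊔-mem (c∈x zero) (proj₂ (⋁ (c∈x ∘ suc) (T ∘ suc)))
    ... | false = ⋁ (c∈x ∘ suc) (T ∘ suc)

    ⋁-least : ∀ {m s} {c : Fin m → U} (c∈x : ∀ k → Mem x (c k)) T →
              p ⊑ s → (∀ k → T k ≡ true → c k ⊑ s) → proj₁ (⋁ c∈x T) ⊑ s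
    ⋁-least {zero}  c∈x T p⊑s c⊑s = p⊑s
    ⋁-least {suc m} c∈x T p⊑s c⊑s with T zero in eq
    ... | true  = ⊔-least-sum (c∈x zero) (proj₂ (⋁ (c∈x ∘ suc) (T ∘ suc))) (c⊑s zero eq)
                    (⋁-least (c∈x ∘ suc) (T ∘ suc) p⊑s (c⊑s ∘ suc))
    ... | false = ⋁-least (c∈x ∘ suc) (T ∘ suc) p⊑s (c⊑s ∘ suc)

    ⋁-base : ∀ {m} {c : Fin m → U} (c∈x : ∀ k → Mem x (c k)) T → p ⊑ proj₁ (⋁ c∈x T)
    ⋁-base {zero}  c∈x T = ε
    ⋁-base {suc m} c∈x T with T zero
    ... | true  = ⋁-base (c∈x ∘ suc) (T ∘ suc) ◅◅
                  step (proj₂ rest) (⊔-mem (c∈x zero) (proj₂ rest))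
                    (⊔-upperʳ (c∈x zero) (proj₂ rest))
      where rest = ⋁ (c∈x ∘ suc) (T ∘ suc)
    ... | false = ⋁-base (c∈x ∘ suc) (T ∘ suc)

    ⋁-upper : ∀ {m} {c : Fin m → U} (c∈x : ∀ k → Mem x (c k)) T →
              ∀ k → T k ≡ true → c k ⊑ proj₁ (⋁ c∈x T)
    ⋁-upper c∈x T zero eq rewrite eq =
      step (c∈x zero) (⊔-mem (c∈x zero) (proj₂ rest)) (⊔-upperˡ (c∈x zero) (proj₂ rest))
      where rest = ⋁ (c∈x ∘ suc) (T ∘ suc)
    ⋁-upper c∈x T (suc k) eq with T zero
    ... | true  = ⋁-upper (c∈x ∘ suc) (T ∘ suc) k eq ◅◅
                  step (proj₂ rest) (⊔-mem (c∈x zero) (proj₂ rest))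
                    (⊔-upperʳ (c∈x zero) (proj₂ rest))
      where rest = ⋁ (c∈x ∘ suc) (T ∘ suc)
    ... | false = ⋁-upper (c∈x ∘ suc) (T ∘ suc) k eq

    -- The `s i`, which may lie outside the component, separate the joins: if `T′` omits `i`, its
    -- join is below `s i`, so a set containing `i` cannot have a smaller join without forcing
    -- `c i ⊑ s i`.
    crown-embedding : ∀ {m} {c s : Fin m → U} (c∈x : ∀ k → Mem x (c k)) →
      (∀ i → p ⊑ s i) → (∀ i k → k ≢ i → c k ⊑ s i) → (∀ i → ¬ c i ⊑ s i) →
      IsOrderEmbeddingOf2^ (Mem x) (Le x) m (proj₁ ∘ ⋁ c∈x)
    crown-embedding {m} {c} {s} c∈x p⊑s c⊑s c⋢s =
      (λ T → proj₂ (⋁ c∈x T)) , λ T T′ → reflects T T′ , preserves T T′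
      where
      reflects : ∀ T T′ → Le x (proj₁ (⋁ c∈x T)) (proj₁ (⋁ c∈x T′)) →
                 _⊆B_ (Mem x) (Le x) T T′
      reflects T T′ le i with T i in Ti | T′ i in T′i
      ... | false | _     = tt
      ... | true  | true  = tt
      ... | true  | false = c⋢s i
        (⋁-upper c∈x T i Ti ◅◅ step (proj₂ (⋁ c∈x T)) (proj₂ (⋁ c∈x T′)) le ◅◅
         ⋁-least c∈x T′ (p⊑s i) λ k T′k → c⊑s i k λ { refl → false≢true T′i T′k })
        where
        false≢true : ∀ {b} → b ≡ false → b ≢ true
        false≢true refl ()

      preserves : ∀ T T′ → _⊆B_ (Mem x) (Le x) T T′ →
                  Le x (proj₁ (⋁ c∈x T)) (proj₁ (⋁ c∈x T′))
      preserves T T′ T⊆T′ = ⊑⇒Le (proj₂ (⋁ c∈x T)) (proj₂ (⋁ c∈x T′))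
        (⋁-least c∈x T (⋁-base c∈x T′) λ k Tk → ⋁-upper c∈x T′ k (member k Tk))
        where
        member : ∀ k → T k ≡ true → T′ k ≡ true
        member k Tk with T k | T′ k | T⊆T′ k
        ... | true | true | _ = refl

  -- The index is raised for one step at a time; as `p` stays in every component met, `raise`
  -- carries along the nodes already placed.
  common-index : ∀ {m x p} {c : Fin m → U} → Mem x p → (∀ k → Step F p (c k)) →
                 ∃[ y ] x ≤S y × Mem y p × (∀ k → Mem y (c k) × Le y p (c k))
  common-index {zero}  p∈x steps = _ , S.refl tt , p∈x , λ ()
  common-index {suc m} p∈x steps =
    let y , x≤y , p∈y , c∈y , p≤c = raise-step p∈x (steps zero)
        z , y≤z , p∈z , rest = common-index p∈y (steps ∘ suc)
    in z , ≤S-trans x≤y y≤z , p∈z ,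
       λ { zero → raise y≤z p∈z p∈y c∈y p≤c ; (suc k) → rest k }

  -- Descent on the total length of the paths.

  record FirstStep {p a} (r : p ⊑ a) : Set where
    field
      {next}  : U
      first   : Step F p next
      rest    : next ⊑ a
      shorter : len rest < len r

  firstStep : ∀ {p a} (r : p ⊑ a) → p ≢ a → FirstStep r
  firstStep ε       p≢a = contradiction refl p≢a
  firstStep (s ◅ r) p≢a = record { first = s ; rest = r ; shorter = ≤-refl }

  module _ {n} (breadth : ∀ x → BreadthAtMost (Mem x) (Le x) n)
           {m} (m≰n : ¬ m ≤ n) (s : Fin m → U) where

    -- Whether `next j ⊑ s j` holds is never decided: assuming it gives a crown over `next j` of
    -- smaller total length, which `rec` refutes. So `c⋢s` holds for every `j`, and
    -- `crown-embedding` contradicts `m≰n`.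
    no-crown : ∀ {x p} {a : Fin m → U} → Mem x p → (r : ∀ k → p ⊑ a k) →
      (∀ i → p ⊑ s i) → (∀ i k → k ≢ i → a k ⊑ s i) → (∀ i → ¬ a i ⊑ s i) →
      ¬ Acc _<_ (total (λ k → len (r k)))
    no-crown {x} {p} {a} p∈x r p⊑s a⊑s a⋢s (acc rec) =
      m≰n (breadth y m _ (crown-embedding p∈y c∈y p⊑s
        (λ i k k≢i → rest k ◅◅ a⊑s i k k≢i) c⋢s))
      where
      split : ∀ k → FirstStep (r k)
      split k = firstStep (r k) λ p≡a → a⋢s k (subst (_⊑ s k) p≡a (p⊑s k))

      open module Split k = FirstStep (split k)

      common = common-index p∈x first
      y   = proj₁ common
      p∈y = proj₁ (proj₂ (proj₂ common))

      c∈y : ∀ k → Mem y (next k)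
      c∈y k = proj₁ (proj₂ (proj₂ (proj₂ common)) k)

      p≤c : ∀ k → Le y p (next k)
      p≤c k = proj₂ (proj₂ (proj₂ (proj₂ common)) k)

      c⋢s : ∀ j → ¬ next j ⊑ s j
      c⋢s j c⊑sⱼ = no-crown (c∈y j) r′ c⊑s
          (λ i k k≢i → least k (c⊑s i) (a⊑s i k k≢i))
          (λ i a′⊑s → a⋢s i (a⊑a′ i ◅◅ a′⊑s))
          (rec (total-mono-< len≤ j len<))
        where
        c⊑s : ∀ i → next j ⊑ s i
        c⊑s i with j ≟ i
        ... | yes refl = c⊑sⱼ
        ... | no  j≢i  = rest j ◅◅ a⊑s i j j≢i

        pushed : ∀ k → ∃[ a′ ]
          (Σ[ q ∈ next j ⊑ a′ ] len q ≤ len (r k) × (k ≡ j → len q < len (r k))) ×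
          a k ⊑ a′ × (∀ {t} → next j ⊑ t → a k ⊑ t → a′ ⊑ t)
        pushed k with k ≟ j
        -- For `k` equal to `j`, dropping the first step suffices, as `a j` is already above
        -- `next j`; this is the strict decrease.
        ... | yes refl = a k , (rest k , <⇒≤ (shorter k) , λ _ → shorter k) , ε , λ _ a⊑t → a⊑t
        ... | no  k≢j  =
          let a′ , (q , len≡) , bounds = join-path p∈y (c∈y j) (p≤c j) (r k)
          in a′ , (q , ≤-reflexive len≡ , λ k≡j → contradiction k≡j k≢j) , bounds

        r′ : ∀ k → next j ⊑ proj₁ (pushed k)
        r′ k = proj₁ (proj₁ (proj₂ (pushed k)))

        len≤ : ∀ k → len (r′ k) ≤ len (r k)
        len≤ k = proj₁ (proj₂ (proj₁ (proj₂ (pushed k))))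

        len< : len (r′ j) < len (r j)
        len< = proj₂ (proj₂ (proj₁ (proj₂ (pushed j)))) refl

        a⊑a′ : ∀ k → a k ⊑ proj₁ (pushed k)
        a⊑a′ k = proj₁ (proj₂ (proj₂ (pushed k)))

        least : ∀ k {t} → next j ⊑ t → a k ⊑ t → proj₁ (pushed k) ⊑ t
        least k = proj₂ (proj₂ (proj₂ (pushed k)))

  sum-breadth : ∀ {n} → (∀ x → BreadthAtMost (Mem x) (Le x) n) →
                BreadthAtMost (InSum F) (_≤Sum_ F) n
  sum-breadth {n} breadth m φ (φ∈L , φ-order) with m ≤? n
  ... | yes m≤n = m≤n
  -- The base is the image of the empty set, the `a k` are the images of the atoms and the `s i`
  -- those of the coatoms: an atom is below a coatom exactly when their indices differ.
  ... | no  m≰n = ⊥-elim (no-crown breadth m≰n (φ ∘ coatom) (proj₂ (φ∈L _))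
      (λ k → mono bottom (atom k) λ _ → tt)
      (λ i → mono bottom (coatom i) λ _ → tt)
      (λ i k k≢i → mono (atom k) (coatom i) (atom⊆coatom k≢i))
      (λ i φ⊑ → atom⊈coatom i
        (proj₁ (φ-order (atom i) (coatom i)) (fromStar (step-refl (proj₂ (φ∈L (atom i)))) φ⊑)))
      (<-wellFounded _))
    where
    _⊆_ : (Fin m → Bool) → (Fin m → Bool) → Set
    _⊆_ = _⊆B_ (InSum F) (_≤Sum_ F)

    bottom : Fin m → Bool
    bottom _ = false

    atom coatom : Fin m → Fin m → Bool
    atom   k l = does (l ≟ k)
    coatom i l = not (does (l ≟ i))

    mono : ∀ T T′ → T ⊆ T′ → φ T ⊑ φ T′
    mono T T′ T⊆T′ = toStar (proj₂ (φ-order T T′) T⊆T′)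

    atom⊆coatom : ∀ {i k} → k ≢ i → atom k ⊆ coatom i
    atom⊆coatom {i} {k} k≢i l with l ≟ k | l ≟ i
    ... | no  _    | _        = tt
    ... | yes refl | yes refl = contradiction refl k≢i
    ... | yes _    | no  _    = tt

    atom⊈coatom : ∀ i → ¬ atom i ⊆ coatom i
    atom⊈coatom i ⊆ with i ≟ i | ⊆ i
    ... | yes _   | ()
    ... | no  i≢i | _ = i≢i refl

theorem3p3 : (S : FLLattice) (U : Set) (F : Family S U) (n : ℕ) →
    IsGluedSystem F →
    (∀ x → Semimodular (Family.Mem F x) (Family.Le F x)) →
    (∀ x → BreadthAtMost (Family.Mem F x) (Family.Le F x) n) →
    Semimodular (InSum F) (_≤Sum_ F) × BreadthAtMost (InSum F) (_≤Sum_ F) n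
theorem3p3 S U F n glued semi breadth = sum-semimodular semi , sum-breadth breadth
  where open GluedSum F glued
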